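{- Let $G=(V,E)$ be a finite graph (loops and multiple edges allowed) with $|V|=m$ and $|E|=n$, and let $f\in\mathrm{Harm}_d(n)$. Then for any label $s:E\to\{1,\dots,n\}$ of $G$, $$\chi_f(G(s);\lambda)=(-1)^{\rho(E)+d}\,\lambda^{k(G)}\,T_f(M_G(s);1-\lambda,0),$$ where $M_G$ is the graphic matroid of $G$, $\rho$ its rank function, and $k(G)$ the number of connected components of $G$.
   Context: Let $\Omega=\{1,\dots,n\}$ and $\Omega_d=\{Z\subset\Omega:|Z|=d\}$. Real-valued functions $f$ on $\Omega_d$ are identified with formal sums $f=\sum_{Z\in\Omega_d}f(Z)Z$ in $\mathbb R\Omega_d$. Let $\gamma$ be the linear map with $\gamma(Z)=\sum_{Y\in\Omega_{d-1},\,Y\subset Z}Y$ for $Z\in\Omega_d$; $\mathrm{Harm}_d(n)=\ker(\gamma|_{\mathbb R\Omega_d})$ is the space of (discrete) harmonic functions of degree $d$. For $X\subset\Omega$ put $\widetilde f(X)=\sum_{Z\in\Omega_d,\,Z\subset X}f(Z)$. A label of $G$ is a bijection $s:E\to\Omega$; it is also a label of $M_G$, whose ground set is $E$. For $A\subset E$, $G_A=(V,A)$, $k(G_A)$ is its number of connected components, and the rank function of $M_G$ is $\rho(A)=|V|-k(G_A)$. Definitions: $$\chi_f(G(s);\lambda)=\sum_{A\subset E}\widetilde f(s(E\setminus A))(-1)^{|A|}\lambda^{k(G_A)},$$ $$T_f(M_G(s);x,y)=\sum_{A\subset E}\widetilde f(s(A))(x-1)^{\rho(E)-\rho(A)}(y-1)^{|A|-\rho(A)}.$$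 -}

module Defs where

open import Algebra.Bundles using (CommutativeRing)
open import Algebra.Properties.Semiring.Exp using (_^_)
open import Data.Bool.Base using (true; false; if_then_else_)
open import Data.Fin.Base as Fin using (Fin; zero; suc)
import Data.Fin.Properties as Fin
open import Data.Fin.Subset
open import Data.Fin.Subset.Properties
open import Data.Nat.Base as ℕ using (ℕ; _+_; _∸_)
import Data.Nat.Properties as ℕ
import Data.Nat.Solver as ℕSolver
open import Data.Product.Base using (∃; Σ-syntax; _×_; _,_; proj₁; proj₂)
open import Data.Rational.Base as ℚ using (ℚ; 0ℚ; 1ℚ; ½)
import Data.Rational.Properties as ℚ
import Data.Rational.Solver as ℚSolver
open import Data.Sum.Base using (_⊎_; inj₁; inj₂; [_,_]′)
open import Data.Vec.Base using (_∷_; []; tabulate; here; there)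
open import Data.Vec.Properties using (lookup∘tabulate; []=⇒lookup; lookup⇒[]=)
open import Function.Base using (_∘_; id)
open import Function.Bundles using (_⇔_; mk⇔; Equivalence; _⤖_; Bijection)
open import Level using (Level; 0ℓ; _⊔_)
open import Relation.Binary.Construct.Closure.Equivalence as EqC using (EqClosure)
open import Relation.Binary.Core using (Rel)
open import Relation.Binary.Definitions using (Decidable; tri<; tri≈; tri>)
open import Relation.Binary.PropositionalEquality
open import Relation.Binary.Structures using (IsEquivalence)
open import Relation.Nullary
open import Relation.Nullary.Decidable as Dec using (_→-dec_; _×-dec_; _⊎-dec_)
open import Relation.Unary as U using (Pred)

------------------------------------------------------------------------
-- Real numbers

-- z i j tends to 0 as i and j both tend to infinity.
Small : (ℕ → ℕ → ℚ) → Set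
Small z = ∀ ε → 0ℚ ℚ.< ε → ∃ λ N → ∀ {i j} → N ℕ.≤ i → N ℕ.≤ j → ℚ.∣ z i j ∣ ℚ.< ε

Small-resp : ∀ {z w} → (∀ i j → z i j ≡ w i j) → Small z → Small w
Small-resp eq sz ε ε>0 with N , small ← sz ε ε>0 =
  N , λ {i} {j} p q → subst (λ t → ℚ.∣ t ∣ ℚ.< ε) (eq i j) (small p q)

Small-0 : Small (λ _ _ → 0ℚ)
Small-0 ε ε>0 = 0 , λ _ _ → ε>0

Small-neg : ∀ {z} → Small z → Small (λ i j → ℚ.- z i j)
Small-neg {z} sz ε ε>0 with N , small ← sz ε ε>0 =
  N , λ {i} {j} p q → subst (ℚ._< ε) (sym (ℚ.∣-p∣≡∣p∣ (z i j))) (small p q)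

Small-+ : ∀ {z w} → Small z → Small w → Small (λ i j → z i j ℚ.+ w i j)
Small-+ {z} {w} sz sw ε ε>0
  with M , smallz ← sz (½ ℚ.* ε) (ℚ.*-monoʳ-<-pos ½ ε>0)
     | N , smallw ← sw (½ ℚ.* ε) (ℚ.*-monoʳ-<-pos ½ ε>0) =
  M ℕ.⊔ N , λ {i} {j} p q → begin-strict
    ℚ.∣ z i j ℚ.+ w i j ∣          ≤⟨ ℚ.∣p+q∣≤∣p∣+∣q∣ (z i j) (w i j) ⟩
    ℚ.∣ z i j ∣ ℚ.+ ℚ.∣ w i j ∣
      <⟨ ℚ.+-mono-< (smallz (ℕ.m⊔n≤o⇒m≤o M N p) (ℕ.m⊔n≤o⇒m≤o M N q))
                    (smallw (ℕ.m⊔n≤o⇒n≤o M N p) (ℕ.m⊔n≤o⇒n≤o M N q)) ⟩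
    ½ ℚ.* ε ℚ.+ ½ ℚ.* ε            ≡⟨ ℚ.*-distribʳ-+ ε ½ ½ ⟨
    1ℚ ℚ.* ε                       ≡⟨ ℚ.*-identityˡ ε ⟩
    ε                              ∎
  where open ℚ.≤-Reasoning

record EventuallyBounded (b : ℕ → ℕ → ℚ) : Set where
  field
    bound    : ℚ
    positive : ℚ.Positive bound
    from     : ℕ
    bounded  : ∀ {i j} → from ℕ.≤ i → from ℕ.≤ j → ℚ.∣ b i j ∣ ℚ.≤ bound

Small-* : ∀ {b z} → EventuallyBounded b → Small z → Small (λ i j → b i j ℚ.* z i j)
Small-* {b} {z} bb sz ε ε>0 = scaled (sz δ δ>0)
  where
  open EventuallyBounded bb renaming (bound to B; from to M)
  open ℚ.≤-Reasoning
  instance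
    B>0 : ℚ.Positive B
    B>0 = positive
    B≥0 : ℚ.NonNegative B
    B≥0 = ℚ.pos⇒nonNeg B
    B≢0 : ℚ.NonZero B
    B≢0 = ℚ.pos⇒nonZero B
    1/B>0 : ℚ.Positive (ℚ.1/ B)
    1/B>0 = ℚ.1/pos⇒pos B

  δ : ℚ
  δ = ℚ.1/ B ℚ.* ε

  δ>0 : 0ℚ ℚ.< δ
  δ>0 = subst (ℚ._< δ) (ℚ.*-zeroʳ (ℚ.1/ B)) (ℚ.*-monoʳ-<-pos (ℚ.1/ B) ε>0)

  Bδ≡ε : B ℚ.* δ ≡ ε
  Bδ≡ε = trans (sym (ℚ.*-assoc B (ℚ.1/ B) ε))
    (trans (cong (ℚ._* ε) (ℚ.*-inverseʳ B)) (ℚ.*-identityˡ ε))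

  scaled : (∃ λ N → ∀ {i j} → N ℕ.≤ i → N ℕ.≤ j → ℚ.∣ z i j ∣ ℚ.< δ) →
           ∃ λ N → ∀ {i j} → N ℕ.≤ i → N ℕ.≤ j → ℚ.∣ b i j ℚ.* z i j ∣ ℚ.< ε
  scaled (N , small) = M ℕ.⊔ N , λ {i} {j} p q → begin-strict
    ℚ.∣ b i j ℚ.* z i j ∣        ≡⟨ ℚ.∣p*q∣≡∣p∣*∣q∣ (b i j) (z i j) ⟩
    ℚ.∣ b i j ∣ ℚ.* ℚ.∣ z i j ∣
      ≤⟨ ℚ.*-monoʳ-≤-nonNeg ℚ.∣ z i j ∣ {{ℚ.∣-∣-nonNeg (z i j)}}
           (bounded (ℕ.m⊔n≤o⇒m≤o M N p) (ℕ.m⊔n≤o⇒m≤o M N q)) ⟩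
    B ℚ.* ℚ.∣ z i j ∣
      <⟨ ℚ.*-monoʳ-<-pos B (small (ℕ.m⊔n≤o⇒n≤o M N p) (ℕ.m⊔n≤o⇒n≤o M N q)) ⟩
    B ℚ.* δ                      ≡⟨ Bδ≡ε ⟩
    ε                            ∎

-- The standard library has no real numbers; they are taken here to be
-- Cauchy sequences of rationals, two sequences being equal when their
-- difference tends to 0.  Eta is off, and the operations are defined by
-- copatterns, so that unification does not unfold the Cauchy proofs.
record ℝ : Set where
  no-eta-equality
  field
    approx : ℕ → ℚ
    cauchy : Small (λ i j → approx i ℚ.- approx j)

open ℝ

infix 4 _≈ℝ_
record _≈ℝ_ (x y : ℝ) : Set where
  constructor equal
  field
    close : ∀ ε → 0ℚ ℚ.< ε →
            ∃ λ N → ∀ {i} → N ℕ.≤ i → ℚ.∣ approx x i ℚ.- approx y i ∣ ℚ.< ε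

open _≈ℝ_

≈ℝ⇒Small : ∀ {x y} → x ≈ℝ y → Small (λ i _ → approx x i ℚ.- approx y i)
≈ℝ⇒Small eq ε ε>0 with N , small ← close eq ε ε>0 = N , λ p _ → small p

Small⇒≈ℝ : ∀ {x y} → Small (λ i _ → approx x i ℚ.- approx y i) → x ≈ℝ y
Small⇒≈ℝ sz = equal λ ε ε>0 → proj₁ (sz ε ε>0) , λ p → proj₂ (sz ε ε>0) p p

pointwise⇒≈ℝ : ∀ {x y} → (∀ i → approx x i ≡ approx y i) → x ≈ℝ y
pointwise⇒≈ℝ {x} {y} eq = Small⇒≈ℝ (Small-resp
  (λ i _ → sym (trans (cong (ℚ._- approx y i) (eq i)) (ℚ.+-inverseʳ (approx y i)))) Small-0)

approx-bounded : ∀ x → EventuallyBounded (λ i _ → approx x i)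
approx-bounded x = record
  { bound    = 1ℚ ℚ.+ ℚ.∣ c ∣
  ; positive = ℚ.pos+nonNeg⇒pos 1ℚ ℚ.∣ c ∣ {{ℚ.∣-∣-nonNeg c}}
  ; from     = N
  ; bounded  = λ {i} p _ → begin
      ℚ.∣ approx x i ∣                     ≡⟨ cong ℚ.∣_∣ (split (approx x i) c) ⟩
      ℚ.∣ (approx x i ℚ.- c) ℚ.+ c ∣       ≤⟨ ℚ.∣p+q∣≤∣p∣+∣q∣ (approx x i ℚ.- c) c ⟩
      ℚ.∣ approx x i ℚ.- c ∣ ℚ.+ ℚ.∣ c ∣
        ≤⟨ ℚ.+-monoˡ-≤ ℚ.∣ c ∣ (ℚ.<⇒≤ (proj₂ tail p ℕ.≤-refl)) ⟩
      1ℚ ℚ.+ ℚ.∣ c ∣                       ∎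
  }
  where
  open ℚ.≤-Reasoning
  open ℚSolver.+-*-Solver
  tail = cauchy x 1ℚ (ℚ.positive⁻¹ 1ℚ)
  N = proj₁ tail
  c = approx x N
  split : ∀ a b → a ≡ (a ℚ.- b) ℚ.+ b
  split = solve 2 (λ a b → a := (a :- b) :+ b) refl

private
  module Rearrange where
    open ℚSolver.+-*-Solver

    minus-+ : ∀ a b c d → (a ℚ.- c) ℚ.+ (b ℚ.- d) ≡ (a ℚ.+ b) ℚ.- (c ℚ.+ d)
    minus-+ = solve 4 (λ a b c d → (a :- c) :+ (b :- d) := (a :+ b) :- (c :+ d)) refl

    minus-* : ∀ a b c d → a ℚ.* (b ℚ.- d) ℚ.+ d ℚ.* (a ℚ.- c) ≡ a ℚ.* b ℚ.- c ℚ.* d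
    minus-* = solve 4 (λ a b c d → a :* (b :- d) :+ d :* (a :- c) := a :* b :- c :* d) refl

    minus-neg : ∀ a b → ℚ.- (a ℚ.- b) ≡ ℚ.- a ℚ.- (ℚ.- b)
    minus-neg = solve 2 (λ a b → :- (a :- b) := :- a :- (:- b)) refl

    minus-swap : ∀ a b → ℚ.- (a ℚ.- b) ≡ b ℚ.- a
    minus-swap = solve 2 (λ a b → :- (a :- b) := b :- a) refl

    minus-trans : ∀ a b c → (a ℚ.- b) ℚ.+ (b ℚ.- c) ≡ a ℚ.- c
    minus-trans = solve 3 (λ a b c → (a :- b) :+ (b :- c) := a :- c) refl

  open Rearrange using (minus-+; minus-*; minus-neg; minus-swap; minus-trans)

bounded-swap : ∀ {b} → EventuallyBounded b → EventuallyBounded (λ i j → b j i)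
bounded-swap bb = record
  { bound = bound ; positive = positive ; from = from ; bounded = λ p q → bounded q p }
  where open EventuallyBounded bb

fromℚ : ℚ → ℝ
approx (fromℚ q) _ = q
cauchy (fromℚ q) = Small-resp (λ _ _ → sym (ℚ.+-inverseʳ q)) Small-0

0ℝ 1ℝ : ℝ
0ℝ = fromℚ 0ℚ
1ℝ = fromℚ 1ℚ

infix  8 -ℝ_
infixl 7 _*ℝ_
infixl 6 _+ℝ_

_+ℝ_ : ℝ → ℝ → ℝ
approx (x +ℝ y) i = approx x i ℚ.+ approx y i
cauchy (x +ℝ y) = Small-resp
  (λ i j → minus-+ (approx x i) (approx y i) (approx x j) (approx y j))
  (Small-+ (cauchy x) (cauchy y))

_*ℝ_ : ℝ → ℝ → ℝ
approx (x *ℝ y) i = approx x i ℚ.* approx y i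
cauchy (x *ℝ y) = Small-resp
  (λ i j → minus-* (approx x i) (approx y i) (approx x j) (approx y j))
  (Small-+ (Small-* (approx-bounded x) (cauchy y))
           (Small-* (bounded-swap (approx-bounded y)) (cauchy x)))

-ℝ_ : ℝ → ℝ
approx (-ℝ x) i = ℚ.- approx x i
cauchy (-ℝ x) = Small-resp (λ i j → minus-neg (approx x i) (approx x j)) (Small-neg (cauchy x))


+ℝ-cong : ∀ {x x′ y y′} → x ≈ℝ x′ → y ≈ℝ y′ → x +ℝ y ≈ℝ x′ +ℝ y′
+ℝ-cong {x} {x′} {y} {y′} p q = Small⇒≈ℝ
  (Small-resp (λ i _ → minus-+ (approx x i) (approx y i) (approx x′ i) (approx y′ i))
    (Small-+ (≈ℝ⇒Small p) (≈ℝ⇒Small q)))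

*ℝ-cong : ∀ {x x′ y y′} → x ≈ℝ x′ → y ≈ℝ y′ → x *ℝ y ≈ℝ x′ *ℝ y′
*ℝ-cong {x} {x′} {y} {y′} p q = Small⇒≈ℝ
  (Small-resp (λ i _ → minus-* (approx x i) (approx y i) (approx x′ i) (approx y′ i))
    (Small-+ (Small-* (approx-bounded x) (≈ℝ⇒Small q))
             (Small-* (approx-bounded y′) (≈ℝ⇒Small p))))

-ℝ-cong : ∀ {x y} → x ≈ℝ y → -ℝ x ≈ℝ -ℝ y
-ℝ-cong {x} {y} p = Small⇒≈ℝ
  (Small-resp (λ i _ → minus-neg (approx x i) (approx y i))
    (Small-neg (≈ℝ⇒Small p)))

≈ℝ-refl : ∀ {x} → x ≈ℝ x
≈ℝ-refl {x} = pointwise⇒≈ℝ (λ _ → refl)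

≈ℝ-sym : ∀ {x y} → x ≈ℝ y → y ≈ℝ x
≈ℝ-sym {x} {y} p = Small⇒≈ℝ
  (Small-resp (λ i _ → minus-swap (approx x i) (approx y i)) (Small-neg (≈ℝ⇒Small p)))

≈ℝ-trans : ∀ {x y z} → x ≈ℝ y → y ≈ℝ z → x ≈ℝ z
≈ℝ-trans {x} {y} {z} p q = Small⇒≈ℝ
  (Small-resp (λ i _ → minus-trans (approx x i) (approx y i) (approx z i))
    (Small-+ (≈ℝ⇒Small p) (≈ℝ⇒Small q)))

+ℝ-assoc : ∀ x y z → (x +ℝ y) +ℝ z ≈ℝ x +ℝ (y +ℝ z)
+ℝ-assoc x y z = pointwise⇒≈ℝ λ i → ℚ.+-assoc (approx x i) (approx y i) (approx z i)

+ℝ-comm : ∀ x y → x +ℝ y ≈ℝ y +ℝ x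
+ℝ-comm x y = pointwise⇒≈ℝ λ i → ℚ.+-comm (approx x i) (approx y i)

+ℝ-identityˡ : ∀ x → 0ℝ +ℝ x ≈ℝ x
+ℝ-identityˡ x = pointwise⇒≈ℝ λ i → ℚ.+-identityˡ (approx x i)

+ℝ-identityʳ : ∀ x → x +ℝ 0ℝ ≈ℝ x
+ℝ-identityʳ x = pointwise⇒≈ℝ λ i → ℚ.+-identityʳ (approx x i)

-ℝ-inverseˡ : ∀ x → (-ℝ x) +ℝ x ≈ℝ 0ℝ
-ℝ-inverseˡ x = pointwise⇒≈ℝ λ i → ℚ.+-inverseˡ (approx x i)

-ℝ-inverseʳ : ∀ x → x +ℝ (-ℝ x) ≈ℝ 0ℝ
-ℝ-inverseʳ x = pointwise⇒≈ℝ λ i → ℚ.+-inverseʳ (approx x i)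

*ℝ-assoc : ∀ x y z → (x *ℝ y) *ℝ z ≈ℝ x *ℝ (y *ℝ z)
*ℝ-assoc x y z = pointwise⇒≈ℝ λ i → ℚ.*-assoc (approx x i) (approx y i) (approx z i)

*ℝ-comm : ∀ x y → x *ℝ y ≈ℝ y *ℝ x
*ℝ-comm x y = pointwise⇒≈ℝ λ i → ℚ.*-comm (approx x i) (approx y i)

*ℝ-identityˡ : ∀ x → 1ℝ *ℝ x ≈ℝ x
*ℝ-identityˡ x = pointwise⇒≈ℝ λ i → ℚ.*-identityˡ (approx x i)

*ℝ-identityʳ : ∀ x → x *ℝ 1ℝ ≈ℝ x
*ℝ-identityʳ x = pointwise⇒≈ℝ λ i → ℚ.*-identityʳ (approx x i)

*ℝ-distribˡ-+ℝ : ∀ x y z → x *ℝ (y +ℝ z) ≈ℝ x *ℝ y +ℝ x *ℝ z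
*ℝ-distribˡ-+ℝ x y z = pointwise⇒≈ℝ λ i →
  ℚ.*-distribˡ-+ (approx x i) (approx y i) (approx z i)

*ℝ-distribʳ-+ℝ : ∀ x y z → (y +ℝ z) *ℝ x ≈ℝ y *ℝ x +ℝ z *ℝ x
*ℝ-distribʳ-+ℝ x y z = pointwise⇒≈ℝ λ i →
  ℚ.*-distribʳ-+ (approx x i) (approx y i) (approx z i)

ℝ-commutativeRing : CommutativeRing 0ℓ 0ℓ
ℝ-commutativeRing = record
  { Carrier = ℝ
  ; _≈_ = _≈ℝ_
  ; _+_ = _+ℝ_
  ; _*_ = _*ℝ_
  ; -_  = -ℝ_
  ; 0#  = 0ℝ
  ; 1#  = 1ℝ
  ; isCommutativeRing = record
    { isRing = record
      { +-isAbelianGroup = record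
        { isGroup = record
          { isMonoid = record
            { isSemigroup = record
              { isMagma = record
                { isEquivalence = record
                  { refl = ≈ℝ-refl ; sym = ≈ℝ-sym ; trans = ≈ℝ-trans }
                ; ∙-cong = +ℝ-cong
                }
              ; assoc = +ℝ-assoc
              }
            ; identity = +ℝ-identityˡ , +ℝ-identityʳ
            }
          ; inverse = -ℝ-inverseˡ , -ℝ-inverseʳ
          ; ⁻¹-cong = -ℝ-cong
          }
        ; comm = +ℝ-comm
        }
      ; *-cong = *ℝ-cong
      ; *-assoc = *ℝ-assoc
      ; *-identity = *ℝ-identityˡ , *ℝ-identityʳ
      ; distrib = *ℝ-distribˡ-+ℝ , *ℝ-distribʳ-+ℝ
      }
    ; *-comm = *ℝ-comm
    }
  }

infixl 6 _-ℝ_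
_-ℝ_ : ℝ → ℝ → ℝ
_-ℝ_ = CommutativeRing._-_ ℝ-commutativeRing

------------------------------------------------------------------------
-- Subsets and equivalence classes of a finite set

⟦_⟧ : ∀ {n} {P : Pred (Fin n) 0ℓ} → U.Decidable P → Subset n
⟦ P? ⟧ = tabulate (λ i → does (P? i))

∈⟦⟧⇔ : ∀ {n} {P : Pred (Fin n) 0ℓ} (P? : U.Decidable P) {i} → i ∈ ⟦ P? ⟧ ⇔ P i
∈⟦⟧⇔ {P = P} P? {i} = mk⇔ to from
  where
  to : i ∈ ⟦ P? ⟧ → P i
  to i∈ with P? i | trans (sym (lookup∘tabulate (λ i → does (P? i)) i)) ([]=⇒lookup i∈)
  ... | yes p | _  = p
  ... | no  _ | ()
  from : P i → i ∈ ⟦ P? ⟧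
  from p = lookup⇒[]= i _ (trans (lookup∘tabulate (λ i → does (P? i)) i) (Dec.dec-true (P? i) p))

∣p∪⁅x⁆∣ : ∀ {n} {p : Subset n} {x} → x ∉ p → ∣ p ∪ ⁅ x ⁆ ∣ ≡ ℕ.suc ∣ p ∣
∣p∪⁅x⁆∣ {p = outside ∷ p} {zero}  x∉p = cong (ℕ.suc ∘ ∣_∣) (∪-identityʳ p)
∣p∪⁅x⁆∣ {p = inside  ∷ p} {zero}  x∉p = contradiction here x∉p
∣p∪⁅x⁆∣ {p = outside ∷ p} {suc x} x∉p = ∣p∪⁅x⁆∣ (x∉p ∘ there)
∣p∪⁅x⁆∣ {p = inside  ∷ p} {suc x} x∉p = cong ℕ.suc (∣p∪⁅x⁆∣ (x∉p ∘ there))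

subset-induction : ∀ {n} (P : Pred (Subset n) 0ℓ) → P ⊥ →
                   (∀ p x → x ∉ p → P p → P (p ∪ ⁅ x ⁆)) → ∀ p → P p
subset-induction P base step []            = base
subset-induction P base step (s ∷ p)       = extend s
  where
  out : P (outside ∷ p)
  out = subset-induction (P ∘ (outside ∷_)) base
    (λ q x x∉q → step (outside ∷ q) (suc x) (x∉q ∘ drop-there)) p
  extend : ∀ s → P (s ∷ p)
  extend outside = out
  extend inside  = subst (P ∘ (inside ∷_)) (∪-identityʳ p) (step (outside ∷ p) zero (λ ()) out)

module _ {m : ℕ} where

  IsLeast : Rel (Fin m) 0ℓ → Pred (Fin m) 0ℓ
  IsLeast _~_ v = ∀ u → u ~ v → v Fin.≤ u

  isLeast? : ∀ {_~_ : Rel (Fin m) 0ℓ} → Decidable _~_ → U.Decidable (IsLeast _~_)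
  isLeast? _~?_ v = Fin.all? λ u → (u ~? v) →-dec (v Fin.≤? u)

  -- Each class of an equivalence relation has exactly one least element,
  -- so counting these counts the classes.
  ∣classes∣ : {_~_ : Rel (Fin m) 0ℓ} → Decidable _~_ → ℕ
  ∣classes∣ _~?_ = ∣ ⟦ isLeast? _~?_ ⟧ ∣

  -- For an equivalence relation _~_, the smallest one containing _~_ and
  -- relating u to v.
  Join : Rel (Fin m) 0ℓ → Fin m → Fin m → Rel (Fin m) 0ℓ
  Join _~_ u v x y = x ~ y ⊎ (x ~ u × v ~ y) ⊎ (x ~ v × u ~ y)

  join? : ∀ {_~_ : Rel (Fin m) 0ℓ} → Decidable _~_ → ∀ u v → Decidable (Join _~_ u v)
  join? _~?_ u v x y = (x ~? y) ⊎-dec (((x ~? u) ×-dec (v ~? y)) ⊎-dec ((x ~? v) ×-dec (u ~? y)))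

  module _ {_~_ : Rel (Fin m) 0ℓ} (isEq : IsEquivalence _~_) where

    private module E = IsEquivalence isEq

    join-isEquivalence : ∀ u v → IsEquivalence (Join _~_ u v)
    join-isEquivalence u v = record { refl = inj₁ E.refl ; sym = jsym ; trans = jtrans }
      where
      jsym : ∀ {x y} → Join _~_ u v x y → Join _~_ u v y x
      jsym (inj₁ p)              = inj₁ (E.sym p)
      jsym (inj₂ (inj₁ (p , q))) = inj₂ (inj₂ (E.sym q , E.sym p))
      jsym (inj₂ (inj₂ (p , q))) = inj₂ (inj₁ (E.sym q , E.sym p))
      jtrans : ∀ {x y z} → Join _~_ u v x y → Join _~_ u v y z → Join _~_ u v x z
      jtrans (inj₁ p)              (inj₁ q)              = inj₁ (E.trans p q)
      jtrans (inj₁ p)              (inj₂ (inj₁ (q , r))) = inj₂ (inj₁ (E.trans p q , r))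
      jtrans (inj₁ p)              (inj₂ (inj₂ (q , r))) = inj₂ (inj₂ (E.trans p q , r))
      jtrans (inj₂ (inj₁ (p , q))) (inj₁ r)              = inj₂ (inj₁ (p , E.trans q r))
      jtrans (inj₂ (inj₂ (p , q))) (inj₁ r)              = inj₂ (inj₂ (p , E.trans q r))
      jtrans (inj₂ (inj₁ (p , q))) (inj₂ (inj₁ (r , s))) = inj₂ (inj₁ (p , s))
      jtrans (inj₂ (inj₁ (p , q))) (inj₂ (inj₂ (r , s))) = inj₁ (E.trans p s)
      jtrans (inj₂ (inj₂ (p , q))) (inj₂ (inj₁ (r , s))) = inj₁ (E.trans p s)
      jtrans (inj₂ (inj₂ (p , q))) (inj₂ (inj₂ (r , s))) = inj₂ (inj₂ (p , s))

    least : Decidable _~_ → ∀ v → ∃ λ r → r ~ v × IsLeast _~_ r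
    least _~?_ v with Fin.¬∀⟶∃¬-smallest m (λ u → ¬ (u ~ v)) (λ u → ¬? (u ~? v)) (λ none → none v E.refl)
    ... | r , ¬¬r~v , below = r , r~v , λ u u~r → ℕ.≮⇒≥ λ u<r →
            below (Fin.fromℕ< u<r) (subst (_~ v) (sym (Fin.toℕ-injective
              (trans (Fin.toℕ-inject (Fin.fromℕ< u<r)) (Fin.toℕ-fromℕ< u<r)))) (E.trans u~r r~v))
      where
      r~v : r ~ v
      r~v = Dec.decidable-stable (r ~? v) ¬¬r~v

  ∣classes∣-cong : ∀ {_~_ _≈_ : Rel (Fin m) 0ℓ} (_~?_ : Decidable _~_) (_≈?_ : Decidable _≈_) →
                   (∀ {x y} → x ~ y → x ≈ y) → (∀ {x y} → x ≈ y → x ~ y) →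
                   ∣classes∣ _~?_ ≡ ∣classes∣ _≈?_
  ∣classes∣-cong _~?_ _≈?_ to from = cong ∣_∣ (⊆-antisym
    (λ i∈ → Equivalence.from (∈⟦⟧⇔ (isLeast? _≈?_))
              λ u u≈v → Equivalence.to (∈⟦⟧⇔ (isLeast? _~?_)) i∈ u (from u≈v))
    (λ i∈ → Equivalence.from (∈⟦⟧⇔ (isLeast? _~?_))
              λ u u~v → Equivalence.to (∈⟦⟧⇔ (isLeast? _≈?_)) i∈ u (to u~v)))

  module _ {_~_ : Rel (Fin m) 0ℓ} (isEq : IsEquivalence _~_) (_~?_ : Decidable _~_) where

    private module E = IsEquivalence isEq

    private
      merge′ : ∀ {u v a b} → a ~ u → IsLeast _~_ a → b ~ v → IsLeast _~_ b → a Fin.< b →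
               ∣classes∣ _~?_ ≡ ℕ.suc (∣classes∣ (join? _~?_ u v))
      merge′ {u} {v} {a} {b} a~u a-least b~v b-least a<b =
        trans (cong ∣_∣ (⊆-antisym ⊆₁ ⊆₂)) (∣p∪⁅x⁆∣ b∉)
        where
        S  = ⟦ isLeast? _~?_ ⟧
        S′ = ⟦ isLeast? (join? _~?_ u v) ⟧
        ∈S  = λ {i} → ∈⟦⟧⇔ (isLeast? _~?_) {i}
        ∈S′ = λ {i} → ∈⟦⟧⇔ (isLeast? (join? _~?_ u v)) {i}
        unique : ∀ {r s} → IsLeast _~_ r → IsLeast _~_ s → r ~ s → r ≡ s
        unique {r} {s} p q r~s = Fin.≤-antisym (p s (E.sym r~s)) (q r r~s)
        b∉ : b ∉ S′
        b∉ b∈ = ℕ.<⇒≱ a<b (Equivalence.to ∈S′ b∈ a (inj₂ (inj₁ (a~u , E.sym b~v))))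
        ⊆₁ : S ⊆ S′ ∪ ⁅ b ⁆
        ⊆₁ {w} w∈ with w Fin.≟ b
        ... | yes refl = x∈p∪q⁺ (inj₂ (x∈⁅x⁆ b))
        ... | no  w≢b  = x∈p∪q⁺ (inj₁ (Equivalence.from ∈S′ least′))
          where
          w-least = Equivalence.to ∈S w∈
          least′ : IsLeast (Join _~_ u v) w
          least′ x (inj₁ x~w) = w-least x x~w
          least′ x (inj₂ (inj₁ (x~u , v~w))) =
            contradiction (sym (unique b-least w-least (E.trans b~v v~w))) w≢b
          least′ x (inj₂ (inj₂ (x~v , u~w)))
            with refl ← unique a-least w-least (E.trans a~u u~w) =
            ℕ.≤-trans (ℕ.<⇒≤ a<b) (b-least x (E.trans x~v (E.sym b~v)))
        ⊆₂ : S′ ∪ ⁅ b ⁆ ⊆ S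
        ⊆₂ w∈ with x∈p∪q⁻ S′ ⁅ b ⁆ w∈
        ... | inj₁ w∈S′ = Equivalence.from ∈S λ x x~w → Equivalence.to ∈S′ w∈S′ x (inj₁ x~w)
        ... | inj₂ w∈b with refl ← x∈⁅y⁆⇒x≡y b w∈b = Equivalence.from ∈S b-least

    merge : ∀ {u v} → ¬ (u ~ v) → ∣classes∣ _~?_ ≡ ℕ.suc (∣classes∣ (join? _~?_ u v))
    merge {u} {v} u≁v with least isEq _~?_ u | least isEq _~?_ v
    ... | a , a~u , a-least | b , b~v , b-least with Fin.<-cmp a b
    ...   | tri< a<b _ _ = merge′ a~u a-least b~v b-least a<b
    ...   | tri≈ _ refl _ = contradiction (E.trans (E.sym a~u) b~v) u≁v
    ...   | tri> _ _ b<a = trans (merge′ b~v b-least a~u a-least b<a)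
      (cong ℕ.suc (∣classes∣-cong (join? _~?_ v u) (join? _~?_ u v) flip flip))
      where
      flip : ∀ {u v x y} → Join _~_ u v x y → Join _~_ v u x y
      flip (inj₁ p)        = inj₁ p
      flip (inj₂ (inj₁ p)) = inj₂ (inj₂ p)
      flip (inj₂ (inj₂ p)) = inj₂ (inj₁ p)

    absorb : ∀ {u v} → u ~ v → ∣classes∣ _~?_ ≡ ∣classes∣ (join? _~?_ u v)
    absorb {u} {v} u~v = ∣classes∣-cong _~?_ (join? _~?_ u v) inj₁ back
      where
      back : ∀ {x y} → Join _~_ u v x y → x ~ y
      back (inj₁ p)              = p
      back (inj₂ (inj₁ (p , q))) = E.trans p (E.trans u~v q)
      back (inj₂ (inj₂ (p , q))) = E.trans p (E.trans (E.sym u~v) q)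

------------------------------------------------------------------------
-- Graphs and matroids

-- V = Fin m and E = Fin n.  A loop has equal ends and parallel edges have
-- the same ends; the order of the two ends is immaterial, since only the
-- equivalence closure of adjacency is used.
record Graph (m n : ℕ) : Set where
  field
    ends : Fin n → Fin m × Fin m

open Graph

module _ {m n : ℕ} (G : Graph m n) where

  Adjacent : Subset n → Rel (Fin m) 0ℓ
  Adjacent A u v = ∃ λ e → e ∈ A × ends G e ≡ (u , v)

  Connected : Subset n → Rel (Fin m) 0ℓ
  Connected A = EqClosure (Adjacent A)

  connected-isEquivalence : ∀ A → IsEquivalence (Connected A)
  connected-isEquivalence A = EqC.isEquivalence (Adjacent A)

  private module C {A} = IsEquivalence (connected-isEquivalence A)

  connected-edge : ∀ {A e} → e ∈ A → Connected A (proj₁ (ends G e)) (proj₂ (ends G e))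
  connected-edge e∈A = EqC.return (_ , e∈A , refl)

  connected-mono : ∀ {A B x y} → A ⊆ B → Connected A x y → Connected B x y
  connected-mono A⊆B = EqC.map λ (e , e∈A , eq) → e , A⊆B e∈A , eq

  joinEdge : Subset n → Fin n → Rel (Fin m) 0ℓ
  joinEdge A e = Join (Connected A) (proj₁ (ends G e)) (proj₂ (ends G e))

  connected⇒join : ∀ {A e x y} → Connected (A ∪ ⁅ e ⁆) x y → joinEdge A e x y
  connected⇒join {A} {e} = EqC.fold (join-isEquivalence (connected-isEquivalence A) _ _) edge
    where
    edge : ∀ {x y} → Adjacent (A ∪ ⁅ e ⁆) x y → joinEdge A e x y
    edge (e′ , e′∈ , refl) with x∈p∪q⁻ A ⁅ e ⁆ e′∈
    ... | inj₁ e′∈A = inj₁ (connected-edge e′∈A)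
    ... | inj₂ e′∈e with refl ← x∈⁅y⁆⇒x≡y e e′∈e = inj₂ (inj₁ (C.refl , C.refl))

  join⇒connected : ∀ {A e x y} → joinEdge A e x y → Connected (A ∪ ⁅ e ⁆) x y
  join⇒connected {A} {e} = go
    where
    up : ∀ {x y} → Connected A x y → Connected (A ∪ ⁅ e ⁆) x y
    up = connected-mono (p⊆p∪q ⁅ e ⁆)
    new : Connected (A ∪ ⁅ e ⁆) (proj₁ (ends G e)) (proj₂ (ends G e))
    new = connected-edge (x∈p∪q⁺ (inj₂ (x∈⁅x⁆ e)))
    go : ∀ {x y} → joinEdge A e x y → Connected (A ∪ ⁅ e ⁆) x y
    go (inj₁ p)              = up p
    go (inj₂ (inj₁ (p , q))) = C.trans (up p) (C.trans new (up q))
    go (inj₂ (inj₂ (p , q))) = C.trans (up p) (C.trans (C.sym new) (up q))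

  connected-⊥ : ∀ {x y} → Connected ⊥ x y → x ≡ y
  connected-⊥ = EqC.fold isEquivalence λ (e , e∈⊥ , _) → contradiction e∈⊥ ∉⊥

  connected? : ∀ A → Decidable (Connected A)
  connected? = subset-induction (Decidable ∘ Connected)
    (λ x y → Dec.map′ (λ { refl → C.refl }) connected-⊥ (x Fin.≟ y))
    (λ A e _ dec x y → Dec.map′ join⇒connected connected⇒join (join? dec _ _ x y))

  -- The number of connected components of the spanning subgraph (V , A).
  k : Subset n → ℕ
  k A = ∣classes∣ (connected? A)

  k≤m : ∀ A → k A ℕ.≤ m
  k≤m A = ∣p∣≤n ⟦ isLeast? (connected? A) ⟧

  k-∪⁅⁆ : ∀ A e → k (A ∪ ⁅ e ⁆) ≡ ∣classes∣ (join? (connected? A) (proj₁ (ends G e)) (proj₂ (ends G e)))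
  k-∪⁅⁆ A e = ∣classes∣-cong (connected? (A ∪ ⁅ e ⁆)) (join? (connected? A) _ _)
    connected⇒join join⇒connected

  k-keep : ∀ {A e} → Connected A (proj₁ (ends G e)) (proj₂ (ends G e)) → k A ≡ k (A ∪ ⁅ e ⁆)
  k-keep {A} {e} p =
    trans (absorb (connected-isEquivalence A) (connected? A) p) (sym (k-∪⁅⁆ A e))

  k-drop : ∀ {A e} → ¬ Connected A (proj₁ (ends G e)) (proj₂ (ends G e)) →
           k A ≡ ℕ.suc (k (A ∪ ⁅ e ⁆))
  k-drop {A} {e} ¬p =
    trans (merge (connected-isEquivalence A) (connected? A) ¬p) (cong ℕ.suc (sym (k-∪⁅⁆ A e)))

  k-⊥ : k ⊥ ≡ m
  k-⊥ = trans (cong ∣_∣ (⊆-antisym ⊆⊤ λ {v} _ → Equivalence.from (∈⟦⟧⇔ (isLeast? (connected? ⊥)))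
          λ u u~v → Fin.≤-reflexive (sym (connected-⊥ u~v)))) (∣⊤∣≡n m)

  k-step : ∀ A e → k A ℕ.≤ ℕ.suc (k (A ∪ ⁅ e ⁆)) × k (A ∪ ⁅ e ⁆) ℕ.≤ k A
  k-step A e with connected? A (proj₁ (ends G e)) (proj₂ (ends G e))
  ... | yes p = ℕ.m≤n⇒m≤1+n (ℕ.≤-reflexive (k-keep p)) , ℕ.≤-reflexive (sym (k-keep p))
  ... | no ¬p = ℕ.≤-reflexive (k-drop ¬p) , subst (k (A ∪ ⁅ e ⁆) ℕ.≤_) (sym (k-drop ¬p)) (ℕ.n≤1+n _)

  m≤k+∣A∣ : ∀ A → m ℕ.≤ k A + ∣ A ∣
  m≤k+∣A∣ = subset-induction (λ A → m ℕ.≤ k A + ∣ A ∣)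
    (ℕ.≤-trans (ℕ.≤-reflexive (sym k-⊥)) (ℕ.m≤m+n _ _))
    λ A e e∉A ih → ℕ.≤-trans ih (ℕ.≤-trans (ℕ.+-monoˡ-≤ ∣ A ∣ (proj₁ (k-step A e)))
      (ℕ.≤-reflexive (trans (sym (ℕ.+-suc _ _)) (cong (k (A ∪ ⁅ e ⁆) +_) (sym (∣p∪⁅x⁆∣ e∉A))))))

  k-∪ : ∀ A D → k (A ∪ D) ℕ.≤ k A
  k-∪ A = subset-induction (λ D → k (A ∪ D) ℕ.≤ k A)
    (ℕ.≤-reflexive (cong k (∪-identityʳ A)))
    λ D e _ ih → ℕ.≤-trans (ℕ.≤-reflexive (cong k (sym (∪-assoc A D ⁅ e ⁆))))
      (ℕ.≤-trans (proj₂ (k-step (A ∪ D) e)) ih)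

  k-diminishing : ∀ {X Y} → X ⊆ Y → ∀ e → k Y + k (X ∪ ⁅ e ⁆) ℕ.≤ k (Y ∪ ⁅ e ⁆) + k X
  k-diminishing {X} {Y} X⊆Y e
    with connected? X (proj₁ (ends G e)) (proj₂ (ends G e))
  ... | yes p = ℕ.≤-reflexive (cong₂ _+_ (k-keep (connected-mono X⊆Y p)) (sym (k-keep p)))
  ... | no ¬p = ℕ.≤-trans (ℕ.+-monoˡ-≤ _ (proj₁ (k-step Y e)))
    (ℕ.≤-reflexive (trans (sym (ℕ.+-suc _ _)) (cong (k (Y ∪ ⁅ e ⁆) +_) (sym (k-drop ¬p)))))

  k-supermodular-∪ : ∀ {C A} → C ⊆ A → ∀ D → k A + k (C ∪ D) ℕ.≤ k (A ∪ D) + k C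
  k-supermodular-∪ {C} {A} C⊆A = subset-induction (λ D → k A + k (C ∪ D) ℕ.≤ k (A ∪ D) + k C)
    (ℕ.≤-reflexive (cong₂ _+_ (cong k (sym (∪-identityʳ A))) (cong k (∪-identityʳ C))))
    step
    where
    step : ∀ D e → e ∉ D → k A + k (C ∪ D) ℕ.≤ k (A ∪ D) + k C →
           k A + k (C ∪ (D ∪ ⁅ e ⁆)) ℕ.≤ k (A ∪ (D ∪ ⁅ e ⁆)) + k C
    step D e _ ih rewrite sym (∪-assoc C D ⁅ e ⁆) | sym (∪-assoc A D ⁅ e ⁆) =
      combine (k A) (k (C ∪ D)) (k (A ∪ D)) (k C) ih (k-diminishing C∪D⊆A∪D e)
      where
      C∪D⊆A∪D : C ∪ D ⊆ A ∪ D
      C∪D⊆A∪D x∈ = x∈p∪q⁺ ([ inj₁ ∘ C⊆A , inj₂ ]′ (x∈p∪q⁻ C D x∈))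
      combine : ∀ a x y c {x′ y′} → a + x ℕ.≤ y + c → y + x′ ℕ.≤ y′ + x → a + x′ ℕ.≤ y′ + c
      combine a x y c {x′} {y′} p q = ℕ.+-cancelʳ-≤ (x + y) _ _ (begin
        (a + x′) + (x + y) ≡⟨ solve 4 (λ a x y x′ → (a :+ x′) :+ (x :+ y) := (a :+ x) :+ (y :+ x′)) refl a x y x′ ⟩
        (a + x) + (y + x′) ≤⟨ ℕ.+-mono-≤ p q ⟩
        (y + c) + (y′ + x) ≡⟨ solve 4 (λ c x y y′ → (y :+ c) :+ (y′ :+ x) := (y′ :+ c) :+ (x :+ y)) refl c x y y′ ⟩
        (y′ + c) + (x + y) ∎)
        where
        open ℕ.≤-Reasoning
        open ℕSolver.+-*-Solver

  k-supermodular : ∀ A B → k A + k B ℕ.≤ k (A ∪ B) + k (A ∩ B)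
  k-supermodular A B = subst (λ t → k A + k t ℕ.≤ k (A ∪ B) + k (A ∩ B)) [A∩B]∪B≡B
    (k-supermodular-∪ (p∩q⊆p A B) B)
    where
    [A∩B]∪B≡B : (A ∩ B) ∪ B ≡ B
    [A∩B]∪B≡B = ⊆-antisym (λ x∈ → [ p∩q⊆q A B , id ]′ (x∈p∪q⁻ (A ∩ B) B x∈))
      (q⊆p∪q (A ∩ B) B)

-- A matroid on Fin n, presented by its rank function.
record Matroid (n : ℕ) : Set where
  field
    ρ            : Subset n → ℕ
    ρ≤∣_∣        : ∀ A → ρ A ℕ.≤ ∣ A ∣
    ρ-mono       : ∀ {A B} → A ⊆ B → ρ A ℕ.≤ ρ B
    ρ-submodular : ∀ A B → ρ (A ∪ B) + ρ (A ∩ B) ℕ.≤ ρ A + ρ B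

open Matroid public using (ρ)

graphic : ∀ {m n} → Graph m n → Matroid n
graphic {m} G = record
  { ρ            = λ A → m ∸ k G A
  ; ρ≤∣_∣        = λ A → ℕ.m≤n+o⇒m∸n≤o m (k G A) (m≤k+∣A∣ G A)
  ; ρ-mono       = λ {A} {B} A⊆B → ℕ.∸-monoʳ-≤ m (subst (λ t → k G t ℕ.≤ k G A) (A∪B≡B A⊆B) (k-∪ G A B))
  ; ρ-submodular = λ A B → flip-≤ (k≤m G (A ∪ B)) (k≤m G (A ∩ B)) (k≤m G A) (k≤m G B) (k-supermodular G A B)
  }
  where
  A∪B≡B : ∀ {n} {A B : Subset n} → A ⊆ B → A ∪ B ≡ B
  A∪B≡B {A = A} {B} A⊆B = ⊆-antisym (λ x∈ → [ A⊆B , id ]′ (x∈p∪q⁻ A B x∈)) (q⊆p∪q A B)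

  flip-≤ : ∀ {a b c d} → a ℕ.≤ m → b ℕ.≤ m → c ℕ.≤ m → d ℕ.≤ m → c + d ℕ.≤ a + b →
           (m ∸ a) + (m ∸ b) ℕ.≤ (m ∸ c) + (m ∸ d)
  flip-≤ {a} {b} {c} {d} a≤m b≤m c≤m d≤m p = ℕ.+-cancelʳ-≤ (a + b) _ _ (begin
    ((m ∸ a) + (m ∸ b)) + (a + b) ≡⟨ total a≤m b≤m ⟩
    m + m                         ≡⟨ total c≤m d≤m ⟨
    ((m ∸ c) + (m ∸ d)) + (c + d) ≤⟨ ℕ.+-monoʳ-≤ ((m ∸ c) + (m ∸ d)) p ⟩
    ((m ∸ c) + (m ∸ d)) + (a + b) ∎)
    where
    open ℕ.≤-Reasoning
    open ℕSolver.+-*-Solver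
    total : ∀ {a b} → a ℕ.≤ m → b ℕ.≤ m → ((m ∸ a) + (m ∸ b)) + (a + b) ≡ m + m
    total {a} {b} a≤m b≤m = trans
      (solve 4 (λ x y a b → (x :+ y) :+ (a :+ b) := (x :+ a) :+ (y :+ b)) refl (m ∸ a) (m ∸ b) a b)
      (cong₂ _+_ (ℕ.m∸n+n≡m a≤m) (ℕ.m∸n+n≡m b≤m))

------------------------------------------------------------------------
-- Harmonic functions and the weighted polynomials

Label : ℕ → Set
Label n = Fin n ⤖ Fin n

image : ∀ {n} → Label n → Subset n → Subset n
image s A = ⟦ (λ i → Fin.any? λ e → (e ∈? A) ×-dec (Bijection.to s e Fin.≟ i)) ⟧

Ω : ℕ → ℕ → Set
Ω n d = Σ[ Z ∈ Subset n ] ∣ Z ∣ ≡ d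

-- The sets of size d - 1; there are none when d = 0, so that γ vanishes
-- in degree 0.
Ω⁻ : ℕ → ℕ → Set
Ω⁻ n d = Σ[ Y ∈ Subset n ] ℕ.suc ∣ Y ∣ ≡ d

module Weighted {c ℓ : Level} (R : CommutativeRing c ℓ) where

  open CommutativeRing R
    using (Carrier; _≈_; 0#; 1#; _*_; -_; semiring) renaming (_+_ to _⊕_; _-_ to _⊖_)

  infixr 8 _^ʳ_
  _^ʳ_ : Carrier → ℕ → Carrier
  _^ʳ_ = _^_ semiring

  ∑ : ∀ {n} → (Subset n → Carrier) → Carrier
  ∑ {ℕ.zero}  F = F []
  ∑ {ℕ.suc n} F = ∑ (F ∘ (outside ∷_)) ⊕ ∑ (F ∘ (inside ∷_))

  ∑Ω : ∀ {n d} → (Ω n d → Carrier) → Carrier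
  ∑Ω {n} {d} F = ∑ λ Z → extended Z (∣ Z ∣ ℕ.≟ d)
    where
    extended : ∀ Z → Dec (∣ Z ∣ ≡ d) → Carrier
    extended Z (yes ∣Z∣≡d) = F (Z , ∣Z∣≡d)
    extended Z (no  _)     = 0#

  -- The coefficient of Y in γ(Z).
  γ-basis : ∀ {n d} → Ω n d → Ω⁻ n d → Carrier
  γ-basis (Z , _) (Y , _) = if does (Y ⊆? Z) then 1# else 0#

  γ : ∀ {n d} → (Ω n d → Carrier) → Ω⁻ n d → Carrier
  γ f Y = ∑Ω λ Z → f Z * γ-basis Z Y

  Harmonic : ∀ {n d} → (Ω n d → Carrier) → Set ℓ
  Harmonic {n} {d} f = (Y : Ω⁻ n d) → γ f Y ≈ 0#

  tilde : ∀ {n d} → (Ω n d → Carrier) → Subset n → Carrier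
  tilde f X = ∑Ω λ Z → if does (proj₁ Z ⊆? X) then f Z else 0#

  χ : ∀ {m n d} → (Ω n d → Carrier) → Graph m n → Label n → Carrier → Carrier
  χ f G s t = ∑ λ A → tilde f (image s (∁ A)) * (- 1#) ^ʳ ∣ A ∣ * t ^ʳ k G A

  -- Both truncated subtractions are exact, by ρ-mono and ρ≤∣_∣.
  T : ∀ {n d} → (Ω n d → Carrier) → Matroid n → Label n → Carrier → Carrier → Carrier
  T f M s x y = ∑ λ A →
    tilde f (image s A) * (x ⊖ 1#) ^ʳ (ρ M ⊤ ∸ ρ M A) * (y ⊖ 1#) ^ʳ (∣ A ∣ ∸ ρ M A)

open Weighted ℝ-commutativeRing public using (Harmonic; χ; T) renaming (_^ʳ_ to _^ℝ_)

{-# OPTIONS --safe #-}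

-- A harmonic function of degree d satisfies f~(Ω ∖ X) = (-1)^d f~(X); with
-- this symmetry the two sides agree term by term in A, by comparing signs and
-- powers of λ.  For the symmetry, inclusion–exclusion gives
-- f~(Ω ∖ X) = Σ_{U ⊆ X} (-1)^|U| Σ_{Z ⊇ U} f(Z).  The inner sum is f(U) when
-- |U| = d and empty when |U| > d.  It vanishes when |U| < d: this is
-- harmonicity when |U| = d - 1, and otherwise d - |U| times the inner sum at U
-- is the sum of the inner sums at the sets U ∪ {i}, i ∉ U.
module Submission where

open import Defs
open import Algebra.Bundles using (CommutativeRing)
import Algebra.Properties.CommutativeSemiring.Exp as Exp
import Algebra.Properties.CommutativeMonoid.Mult as CommutativeMult
import Algebra.Properties.Ring as RingProperties
import Algebra.Properties.Semiring.Mult as Mult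
import Algebra.Solver.Ring.NaturalCoefficients.Default as Solver
open import Data.Bool.Base using (Bool; true; false; if_then_else_)
import Data.Fin.Properties as Fin
open import Data.Fin.Subset using (Subset; inside; outside; _∈_; _⊆_; ∁; ∣_∣; ⊤)
open import Data.Fin.Subset.Properties
open import Data.Nat.Base using (ℕ; zero; suc; _+_; _∸_; _≤_; _<_; s≤s)
import Data.Nat.Properties as ℕ
open import Data.Product.Base using (_,_; proj₁)
import Data.Rational.Base as ℚ
import Data.Rational.Properties as ℚ
open import Data.Vec.Base using ([]; _∷_)
open import Function.Base using (_∘_)
open import Function.Bundles using (Bijection; Equivalence)
open import Relation.Binary.Definitions using (tri<; tri≈; tri>)
open import Relation.Binary.PropositionalEquality as ≡ using (_≡_; _≢_)
import Relation.Binary.Reasoning.Setoid as SetoidReasoning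
open import Relation.Nullary using (Dec; does; yes; no; contradiction)
open import Relation.Nullary.Decidable using (_×-dec_)

-- Labels and complements

-- Injectivity of `s` gives `to` and surjectivity gives `from`.
image-∁ : ∀ {n} (s : Label n) A → image s (∁ A) ≡ ∁ (image s A)
image-∁ s A = ⊆-antisym to from
  where
  module s = Bijection s

  hit? : ∀ B i → Dec _
  hit? B i = Fin.any? λ e → (e ∈? B) ×-dec (s.to e Fin.≟ i)

  to : image s (∁ A) ⊆ ∁ (image s A)
  to i∈ with e , e∈∁A , se≡i ← Equivalence.to (∈⟦⟧⇔ (hit? (∁ A))) i∈ =
    x∉p⇒x∈∁p λ i∈A → let e′ , e′∈A , se′≡i = Equivalence.to (∈⟦⟧⇔ (hit? A)) i∈A in
      x∈∁p⇒x∉p e∈∁A (≡.subst (_∈ A) (s.injective (≡.trans se′≡i (≡.sym se≡i))) e′∈A)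

  from : ∁ (image s A) ⊆ image s (∁ A)
  from {i} i∈ with e , se≡ ← s.strictlySurjective i =
    Equivalence.from (∈⟦⟧⇔ (hit? (∁ A))) (e , x∉p⇒x∈∁p e∉A , se≡)
    where
    e∉A = λ e∈A → x∈∁p⇒x∉p i∈ (Equivalence.from (∈⟦⟧⇔ (hit? A)) (e , e∈A , se≡))

-- The argument runs over any commutative ring; beyond the ring laws, the only property of the reals
-- it takes is torsion-freeness.
module HarmonicSums {c ℓ} (R : CommutativeRing c ℓ) where

  open CommutativeRing R hiding (zero)
    renaming (_+_ to _⊕_; +-cong to ⊕-cong; +-congˡ to ⊕-congˡ; +-congʳ to ⊕-congʳ)
  open Weighted R using (∑; ∑Ω; γ; γ-basis; tilde; _^ʳ_)
  open Exp commutativeSemiring using (^-congʳ; ^-congˡ; ^-homo-*; ^-distrib-*)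
  open Mult semiring using (_×_; ×-congʳ; ×-homo-+; ×-assoc-*)
  open RingProperties ring
    using (-1*x≈-x; -‿involutive; +-cancelʳ)
  open CommutativeMult +-commutativeMonoid using (×-distrib-+)
  open Solver commutativeSemiring using (solve; _:=_; _:+_; _:*_)
  open SetoidReasoning setoid

  -- Sums over all subsets

  ∑-cong : ∀ {n} {F H : Subset n → Carrier} → (∀ A → F A ≈ H A) → ∑ F ≈ ∑ H
  ∑-cong {zero}  eq = eq []
  ∑-cong {suc n} eq = ⊕-cong (∑-cong (eq ∘ (outside ∷_))) (∑-cong (eq ∘ (inside ∷_)))

  ∑-0 : ∀ {n} → ∑ {n} (λ _ → 0#) ≈ 0#
  ∑-0 {zero}  = refl
  ∑-0 {suc n} = trans (⊕-cong (∑-0 {n}) (∑-0 {n})) (+-identityˡ 0#)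

  interchange : ∀ w x y z → (w ⊕ x) ⊕ (y ⊕ z) ≈ (w ⊕ y) ⊕ (x ⊕ z)
  interchange = solve 4 (λ w x y z → (w :+ x) :+ (y :+ z) := (w :+ y) :+ (x :+ z)) refl

  ∑-⊕ : ∀ {n} (F H : Subset n → Carrier) → ∑ (λ A → F A ⊕ H A) ≈ ∑ F ⊕ ∑ H
  ∑-⊕ {zero}  F H = refl
  ∑-⊕ {suc n} F H = trans
    (⊕-cong (∑-⊕ (F ∘ (outside ∷_)) (H ∘ (outside ∷_))) (∑-⊕ (F ∘ (inside ∷_)) (H ∘ (inside ∷_))))
    (interchange _ _ _ _)

  *-∑ : ∀ {n} x (F : Subset n → Carrier) → x * ∑ F ≈ ∑ (λ A → x * F A)
  *-∑ {zero}  x F = refl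
  *-∑ {suc n} x F = trans (distribˡ x _ _)
    (⊕-cong (*-∑ x (F ∘ (outside ∷_))) (*-∑ x (F ∘ (inside ∷_))))

  -- Sums over supersets and over subsets

  _when_ : Carrier → Bool → Carrier
  x when b = if b then x else 0#

  when-cong : ∀ {x y} → x ≈ y → ∀ b → x when b ≈ y when b
  when-cong eq true  = eq
  when-cong eq false = refl

  when-0 : ∀ b → 0# when b ≈ 0#
  when-0 true  = refl
  when-0 false = refl

  when-⊕ : ∀ x y b → (x ⊕ y) when b ≈ x when b ⊕ y when b
  when-⊕ x y true  = refl
  when-⊕ x y false = sym (+-identityˡ 0#)

  *-when : ∀ x y b → x * (y when b) ≈ (x * y) when b
  *-when x y true  = refl
  *-when x y false = zeroʳ x

  *-when-1 : ∀ x b → x * (1# when b) ≈ x when b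
  *-when-1 x b = trans (*-when x 1# b) (when-cong (*-identityʳ x) b)

  -- For `g` the extension of `f` by zero, `below g` is f~ and `above g` at sets of size d - 1 is γ
  -- f. Leaving the size of `Z` free lets both be split on the first element of the ground set.
  above below : ∀ {n} → (Subset n → Carrier) → Subset n → Carrier
  above g U = ∑ λ Z → g Z when does (U ⊆? Z)
  below g X = ∑ λ Z → g Z when does (Z ⊆? X)

  ∑-when-⊕ : ∀ {n} (g h : Subset n → Carrier) (b : Subset n → Bool) →
             ∑ (λ Z → (g Z ⊕ h Z) when b Z) ≈ ∑ (λ Z → g Z when b Z) ⊕ ∑ (λ Z → h Z when b Z)
  ∑-when-⊕ {n} g h b = trans (∑-cong {n} λ Z → when-⊕ (g Z) (h Z) (b Z)) (∑-⊕ {n} _ _)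

  *-∑-when : ∀ {n} x (g : Subset n → Carrier) (b : Subset n → Bool) →
             x * ∑ (λ Z → g Z when b Z) ≈ ∑ (λ Z → (x * g Z) when b Z)
  *-∑-when {n} x g b = trans (*-∑ {n} x _) (∑-cong {n} λ Z → *-when x (g Z) (b Z))

  above-cong : ∀ {n} {g h : Subset n → Carrier} → (∀ Z → g Z ≈ h Z) → ∀ U → above g U ≈ above h U
  above-cong eq U = ∑-cong λ Z → when-cong (eq Z) (does (U ⊆? Z))

  below-cong : ∀ {n} {g h : Subset n → Carrier} → (∀ Z → g Z ≈ h Z) → ∀ X → below g X ≈ below h X
  below-cong eq X = ∑-cong λ Z → when-cong (eq Z) (does (Z ⊆? X))

  below-⊕ : ∀ {n} (g h : Subset n → Carrier) X → below (λ Z → g Z ⊕ h Z) X ≈ below g X ⊕ below h X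
  below-⊕ g h X = ∑-when-⊕ g h λ Z → does (Z ⊆? X)

  -- Sets omitting the first element contribute a sum that computes to zeros. For `outside ∷ U` the
  -- splitting into two sums is definitional and needs no lemma.
  above-inside : ∀ {n} (g : Subset (suc n) → Carrier) U → above g (inside ∷ U) ≈ above (g ∘ (inside ∷_)) U
  above-inside {n} g U = trans (⊕-congʳ (∑-0 {n})) (+-identityˡ _)

  below-outside : ∀ {n} (g : Subset (suc n) → Carrier) X → below g (outside ∷ X) ≈ below (g ∘ (outside ∷_)) X
  below-outside {n} g X = trans (⊕-congˡ (∑-0 {n})) (+-identityʳ _)

  above-zero : ∀ {n} {g : Subset n → Carrier} U → (∀ Z → ∣ U ∣ ≤ ∣ Z ∣ → g Z ≈ 0#) → above g U ≈ 0#
  above-zero {n} {g} U g≈0 = trans (∑-cong vanish) (∑-0 {n})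
    where
    vanish : ∀ Z → g Z when does (U ⊆? Z) ≈ 0#
    vanish Z with U ⊆? Z
    ... | yes U⊆Z = g≈0 Z (p⊆q⇒∣p∣≤∣q∣ U⊆Z)
    ... | no  _   = refl

  -- A proper superset of `U` is strictly larger than `U`, so only the term `Z = U` survives.
  above-top : ∀ {n} {g : Subset n → Carrier} U → (∀ Z → ∣ U ∣ < ∣ Z ∣ → g Z ≈ 0#) → above g U ≈ g U
  above-top []            g≈0 = refl
  above-top (outside ∷ U) g≈0 = trans
    (⊕-cong (above-top U (g≈0 ∘ (outside ∷_))) (above-zero U λ Z p → g≈0 (inside ∷ Z) (s≤s p)))
    (+-identityʳ _)
  above-top {g = g} (inside ∷ U) g≈0 = trans (above-inside g U)
    (above-top U λ Z p → g≈0 (inside ∷ Z) (s≤s p))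

  -- Double counting over the covers of a set

  -- Σ_{i ∉ U} h (U ∪ {i})
  coverSum : ∀ {n} → (Subset n → Carrier) → Subset n → Carrier
  coverSum h []            = 0#
  coverSum h (outside ∷ U) = h (inside ∷ U) ⊕ coverSum (h ∘ (outside ∷_)) U
  coverSum h (inside  ∷ U) = coverSum (h ∘ (inside ∷_)) U

  coverSum-cong : ∀ {n} {g h : Subset n → Carrier} → (∀ V → g V ≈ h V) → ∀ U → coverSum g U ≈ coverSum h U
  coverSum-cong eq []            = refl
  coverSum-cong eq (outside ∷ U) = ⊕-cong (eq _) (coverSum-cong (eq ∘ (outside ∷_)) U)
  coverSum-cong eq (inside  ∷ U) = coverSum-cong (eq ∘ (inside ∷_)) U

  coverSum-⊕ : ∀ {n} (g h : Subset n → Carrier) U →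
               coverSum (λ V → g V ⊕ h V) U ≈ coverSum g U ⊕ coverSum h U
  coverSum-⊕ g h []            = sym (+-identityˡ 0#)
  coverSum-⊕ g h (outside ∷ U) = trans (⊕-congˡ (coverSum-⊕ _ _ U)) (interchange _ _ _ _)
  coverSum-⊕ g h (inside  ∷ U) = coverSum-⊕ _ _ U

  coverSum-zero : ∀ {n} {h : Subset n → Carrier} U →
                  (∀ V → ∣ V ∣ ≡ suc ∣ U ∣ → h V ≈ 0#) → coverSum h U ≈ 0#
  coverSum-zero []            h≈0 = refl
  coverSum-zero (outside ∷ U) h≈0 = trans
    (⊕-cong (h≈0 (inside ∷ U) ≡.refl) (coverSum-zero U (h≈0 ∘ (outside ∷_))))
    (+-identityˡ 0#)
  coverSum-zero (inside  ∷ U) h≈0 = coverSum-zero U λ V p → h≈0 (inside ∷ V) (≡.cong suc p)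

  -- Each Z ⊇ U contains U ∪ {i} for exactly |Z| - |U| of the i ∉ U; the |U| is
  -- moved to the left to avoid the subtraction.
  coverSum-above : ∀ {n} (g : Subset n → Carrier) U →
    coverSum (above g) U ⊕ ∣ U ∣ × above g U ≈ above (λ Z → ∣ Z ∣ × g Z) U
  coverSum-above g [] = +-identityˡ 0#
  coverSum-above g (outside ∷ U) = begin
    (above g (inside ∷ U) ⊕ coverSum (λ V → above g₀ V ⊕ above g₁ V) U) ⊕ ∣ U ∣ × (above g₀ U ⊕ above g₁ U)
      ≈⟨ ⊕-cong (⊕-cong (above-inside g U) (coverSum-⊕ (above g₀) (above g₁) U)) (×-distrib-+ _ _ ∣ U ∣) ⟩
    (above g₁ U ⊕ (coverSum (above g₀) U ⊕ coverSum (above g₁) U)) ⊕ (∣ U ∣ × above g₀ U ⊕ ∣ U ∣ × above g₁ U)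
      ≈⟨ solve 5 (λ a x y u v → (a :+ (x :+ y)) :+ (u :+ v) := (x :+ u) :+ (a :+ (y :+ v))) refl _ _ _ _ _ ⟩
    (coverSum (above g₀) U ⊕ ∣ U ∣ × above g₀ U) ⊕ (above g₁ U ⊕ (coverSum (above g₁) U ⊕ ∣ U ∣ × above g₁ U))
      ≈⟨ ⊕-cong (coverSum-above g₀ U) (⊕-congˡ (coverSum-above g₁ U)) ⟩
    above (λ Z → ∣ Z ∣ × g₀ Z) U ⊕ (above g₁ U ⊕ above (λ Z → ∣ Z ∣ × g₁ Z) U)
      -- The cover that adds the first element supplies `above g₁ U`, the extra copy of `g₁ Z` in
      -- `∣ inside ∷ Z ∣ × g₁ Z`.
      ≈⟨ ⊕-congˡ (∑-when-⊕ g₁ (λ Z → ∣ Z ∣ × g₁ Z) λ Z → does (U ⊆? Z)) ⟨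
    above (λ Z → ∣ Z ∣ × g₀ Z) U ⊕ above (λ Z → g₁ Z ⊕ ∣ Z ∣ × g₁ Z) U
      ∎
    where
    g₀ = g ∘ (outside ∷_)
    g₁ = g ∘ (inside ∷_)
  coverSum-above g (inside ∷ U) = begin
    coverSum (above g ∘ (inside ∷_)) U ⊕ (above g (inside ∷ U) ⊕ ∣ U ∣ × above g (inside ∷ U))
      ≈⟨ ⊕-cong (coverSum-cong (above-inside g) U)
           (⊕-cong (above-inside g U) (×-congʳ ∣ U ∣ (above-inside g U))) ⟩
    coverSum (above g₁) U ⊕ (above g₁ U ⊕ ∣ U ∣ × above g₁ U)
      ≈⟨ solve 3 (λ x a u → x :+ (a :+ u) := a :+ (x :+ u)) refl _ _ _ ⟩
    above g₁ U ⊕ (coverSum (above g₁) U ⊕ ∣ U ∣ × above g₁ U)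
      ≈⟨ ⊕-congˡ (coverSum-above g₁ U) ⟩
    above g₁ U ⊕ above (λ Z → ∣ Z ∣ × g₁ Z) U
      ≈⟨ ∑-when-⊕ g₁ (λ Z → ∣ Z ∣ × g₁ Z) (λ Z → does (U ⊆? Z)) ⟨
    above (λ Z → g₁ Z ⊕ ∣ Z ∣ × g₁ Z) U
      ≈⟨ above-inside (λ Z → ∣ Z ∣ × g Z) U ⟨
    above (λ Z → ∣ Z ∣ × g Z) (inside ∷ U)
      ∎
    where
    g₁ = g ∘ (inside ∷_)

  -- Inclusion-exclusion on the complement

  -1^ : ℕ → Carrier
  -1^ j = (- 1#) ^ʳ j

  -- Induction on the ground set. If the first element is outside `X`, then no `U` contains it and
  -- `Z` may or may not, on both sides. If it is in `X`, the terms of `U` with and without it have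
  -- opposite signs, and what cancels is exactly the `Z` containing it.
  below-∁ : ∀ {n} (g : Subset n → Carrier) X →
            below g (∁ X) ≈ below (λ U → -1^ ∣ U ∣ * above g U) X
  below-∁ g [] = sym (*-identityˡ (g []))
  below-∁ g (outside ∷ X) = begin
    below g₀ (∁ X) ⊕ below g₁ (∁ X)
      ≈⟨ ⊕-cong (below-∁ g₀ X) (below-∁ g₁ X) ⟩
    below (λ U → -1^ ∣ U ∣ * above g₀ U) X ⊕ below (λ U → -1^ ∣ U ∣ * above g₁ U) X
      ≈⟨ below-⊕ _ _ X ⟨
    below (λ U → -1^ ∣ U ∣ * above g₀ U ⊕ -1^ ∣ U ∣ * above g₁ U) X
      ≈⟨ below-cong (λ U → distribˡ (-1^ ∣ U ∣) (above g₀ U) (above g₁ U)) X ⟨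
    below (λ U → -1^ ∣ U ∣ * (above g₀ U ⊕ above g₁ U)) X
      ≈⟨ below-outside (λ U → -1^ ∣ U ∣ * above g U) X ⟨
    below (λ U → -1^ ∣ U ∣ * above g U) (outside ∷ X)
      ∎
    where
    g₀ = g ∘ (outside ∷_)
    g₁ = g ∘ (inside ∷_)
  below-∁ g (inside ∷ X) = begin
    below g (outside ∷ ∁ X)
      ≈⟨ below-outside g (∁ X) ⟩
    below g₀ (∁ X)
      ≈⟨ below-∁ g₀ X ⟩
    below (λ U → -1^ ∣ U ∣ * above g₀ U) X
      ≈⟨ below-cong cancel X ⟨
    below (λ U → -1^ ∣ U ∣ * above g (outside ∷ U) ⊕ -1^ (suc ∣ U ∣) * above g (inside ∷ U)) X
      ≈⟨ below-⊕ _ _ X ⟩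
    below (λ U → -1^ ∣ U ∣ * above g U) (inside ∷ X)
      ∎
    where
    g₀ = g ∘ (outside ∷_)
    g₁ = g ∘ (inside ∷_)
    cancel : ∀ U → -1^ ∣ U ∣ * above g (outside ∷ U) ⊕ -1^ (suc ∣ U ∣) * above g (inside ∷ U) ≈
                   -1^ ∣ U ∣ * above g₀ U
    cancel U = begin
      p * (a ⊕ b) ⊕ (- 1# * p) * above g (inside ∷ U) ≈⟨ ⊕-congˡ (*-congˡ (above-inside g U)) ⟩
      p * (a ⊕ b) ⊕ (- 1# * p) * b
        ≈⟨ solve 4 (λ p a b e → p :* (a :+ b) :+ (e :* p) :* b := p :* a :+ p :* (b :+ e :* b)) refl p a b (- 1#) ⟩
      p * a ⊕ p * (b ⊕ - 1# * b)  ≈⟨ ⊕-congˡ (*-congˡ (⊕-congˡ (-1*x≈-x b))) ⟩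
      p * a ⊕ p * (b - b)         ≈⟨ ⊕-congˡ (*-congˡ (-‿inverseʳ b)) ⟩
      p * a ⊕ p * 0#              ≈⟨ ⊕-congˡ (zeroʳ p) ⟩
      p * a ⊕ 0#                  ≈⟨ +-identityʳ _ ⟩
      p * a                       ∎
      where
      p = -1^ ∣ U ∣
      a = above g₀ U
      b = above g₁ U

  -- Extension by zero to all subsets

  -- The function summed inside `∑Ω` is local to it. Unification recovers it as `F` from the type of
  -- the equation, so `extend` agrees with it definitionally.
  summand : ∀ {n} {F : Subset n → Carrier} {x : Carrier} → x ≡ ∑ F → Subset n → Carrier
  summand {F = F} _ = F

  -- f extended by zero to all subsets, read off as the summand of ∑Ω f.
  extend : ∀ {n d} → (Ω n d → Carrier) → Subset n → Carrier
  extend {n} {d} f = summand {x = ∑Ω f} ≡.refl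

  extend-off : ∀ {n d} (f : Ω n d → Carrier) Z → ∣ Z ∣ ≢ d → extend f Z ≈ 0#
  extend-off {d = d} f Z ∣Z∣≢d with ∣ Z ∣ ℕ.≟ d
  ... | yes ∣Z∣≡d = contradiction ∣Z∣≡d ∣Z∣≢d
  ... | no  _     = refl

  γ≈above : ∀ {n d} (f : Ω n d → Carrier) (Y : Ω⁻ n d) → γ f Y ≈ above (extend f) (proj₁ Y)
  γ≈above {n} {d} f (Y , p) = ∑-cong eq
    where
    eq : ∀ Z → extend (λ Z → f Z * γ-basis Z (Y , p)) Z ≈ extend f Z when does (Y ⊆? Z)
    eq Z with ∣ Z ∣ ℕ.≟ d
    ... | yes _ = *-when-1 _ (does (Y ⊆? Z))
    ... | no  _ = sym (when-0 (does (Y ⊆? Z)))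

  tilde≈below : ∀ {n d} (f : Ω n d → Carrier) X → tilde f X ≈ below (extend f) X
  tilde≈below {n} {d} f X = ∑-cong eq
    where
    eq : ∀ Z → extend (λ Z → f Z when does (proj₁ Z ⊆? X)) Z ≈ extend f Z when does (Z ⊆? X)
    eq Z with ∣ Z ∣ ℕ.≟ d
    ... | yes _ = refl
    ... | no  _ = sym (when-0 (does (Z ⊆? X)))

  -- Comparison of single terms of the two polynomials

  -1^-square : ∀ j → -1^ j * -1^ j ≈ 1#
  -1^-square j = begin
    -1^ j * -1^ j          ≈⟨ ^-distrib-* (- 1#) (- 1#) j ⟨
    (- 1# * - 1#) ^ʳ j     ≈⟨ ^-congˡ j (trans (-1*x≈-x (- 1#)) (-‿involutive 1#)) ⟩
    1# ^ʳ j                ≈⟨ 1^ j ⟩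
    1#                     ∎
    where
    1^ : ∀ j → 1# ^ʳ j ≈ 1#
    1^ zero    = refl
    1^ (suc j) = trans (*-identityˡ _) (1^ j)

  -- At x = 1 - t and y = 0 the bases of the powers in T are -t and -1.
  χ-term≈T-term : ∀ t F {a d m k₀ k₁ : ℕ} → k₀ ≤ k₁ → k₁ ≤ m → m ∸ k₁ ≤ a →
    (-1^ d * F) * -1^ a * t ^ʳ k₁ ≈
    (-1^ (m ∸ k₀ + d) * t ^ʳ k₀) *
      (F * ((1# - t) - 1#) ^ʳ (m ∸ k₀ ∸ (m ∸ k₁)) * (0# - 1#) ^ʳ (a ∸ (m ∸ k₁)))
  χ-term≈T-term t F {a} {d} {m} {k₀} {k₁} k₀≤k₁ k₁≤m ρ≤a = begin
    (-1^ d * F) * -1^ a * t ^ʳ k₁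
      ≈⟨ *-cong (*-congˡ -1^a) t^k₁ ⟩
    (-1^ d * F) * (-1^ ρ₁ * -1^ l) * (t ^ʳ k₀ * t ^ʳ j)
      -- Two copies of (-1)^j are inserted: one completes the sign from `ρ₁` to `ρ₀`, the other
      -- turns t^j into (-t)^j.
      ≈⟨ *-identityˡ _ ⟨
    1# * ((-1^ d * F) * (-1^ ρ₁ * -1^ l) * (t ^ʳ k₀ * t ^ʳ j))
      ≈⟨ *-congʳ (-1^-square j) ⟨
    (-1^ j * -1^ j) * ((-1^ d * F) * (-1^ ρ₁ * -1^ l) * (t ^ʳ k₀ * t ^ʳ j))
      ≈⟨ solve 7 (λ j d F r l u v →
           (j :* j) :* ((d :* F) :* (r :* l) :* (u :* v)) :=
           (((j :* r) :* d) :* u) :* (F :* (j :* v) :* l)) refl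
           (-1^ j) (-1^ d) F (-1^ ρ₁) (-1^ l) (t ^ʳ k₀) (t ^ʳ j) ⟩
    (((-1^ j * -1^ ρ₁) * -1^ d) * t ^ʳ k₀) * (F * (-1^ j * t ^ʳ j) * -1^ l)
      ≈⟨ *-cong (*-congʳ sign) (*-cong (*-congˡ power) (^-congˡ l (+-identityˡ (- 1#)))) ⟨
    (-1^ (ρ₀ + d) * t ^ʳ k₀) * (F * ((1# - t) - 1#) ^ʳ j * (0# - 1#) ^ʳ l)
      ∎
    where
    -- With `k₀` for k(G), `k₁` for k(G_A) and `a` for |A|, these are the ranks of E and A, then the
    -- corank `j` and the nullity `l` of A.
    ρ₀ = m ∸ k₀
    ρ₁ = m ∸ k₁
    j = ρ₀ ∸ ρ₁
    l = a ∸ ρ₁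

    j+ρ₁ : j + ρ₁ ≡ ρ₀
    j+ρ₁ = ℕ.m∸n+n≡m (ℕ.∸-monoʳ-≤ m k₀≤k₁)

    k₀+j : k₀ + j ≡ k₁
    -- After adding `ρ₁`, both sides equal `m`.
    k₀+j = ℕ.+-cancelʳ-≡ ρ₁ _ _ (≡.trans (ℕ.+-assoc k₀ j ρ₁)
      (≡.trans (≡.cong (k₀ +_) j+ρ₁)
        (≡.trans (ℕ.m+[n∸m]≡n (ℕ.≤-trans k₀≤k₁ k₁≤m)) (≡.sym (ℕ.m+[n∸m]≡n k₁≤m)))))

    t^k₁ : t ^ʳ k₁ ≈ t ^ʳ k₀ * t ^ʳ j
    t^k₁ = trans (^-congʳ t (≡.sym k₀+j)) (^-homo-* t k₀ j)

    -1^a : -1^ a ≈ -1^ ρ₁ * -1^ l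
    -1^a = trans (^-congʳ (- 1#) (≡.sym (ℕ.m+[n∸m]≡n ρ≤a))) (^-homo-* (- 1#) ρ₁ l)

    sign : -1^ (ρ₀ + d) ≈ (-1^ j * -1^ ρ₁) * -1^ d
    sign = trans (^-homo-* (- 1#) ρ₀ d)
      (*-congʳ (trans (^-congʳ (- 1#) (≡.sym j+ρ₁)) (^-homo-* (- 1#) j ρ₁)))

    power : ((1# - t) - 1#) ^ʳ j ≈ -1^ j * t ^ʳ j
    power = trans (^-congˡ j base) (^-distrib-* (- 1#) t j)
      where
      base : (1# - t) - 1# ≈ - 1# * t
      base = begin
        (1# - t) - 1#      ≈⟨ ⊕-congʳ (+-comm 1# (- t)) ⟩
        (- t ⊕ 1#) - 1#    ≈⟨ +-assoc (- t) 1# (- 1#) ⟩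
        - t ⊕ (1# - 1#)    ≈⟨ ⊕-congˡ (-‿inverseʳ 1#) ⟩
        - t ⊕ 0#           ≈⟨ +-identityʳ (- t) ⟩
        - t                ≈⟨ -1*x≈-x t ⟨
        - 1# * t           ∎

  -- Harmonicity and the complement symmetry

  module _ (torsionFree : ∀ j x → suc j × x ≈ 0# → x ≈ 0#) where

    -- Induction on j = d - 1 - |U|, upwards from the sets of size d - 1, where the claim is
    -- harmonicity itself.
    above-harmonic : ∀ {n d} (f : Ω n d → Carrier) → Weighted.Harmonic R f →
                     ∀ j U → suc j + ∣ U ∣ ≡ d → above (extend f) U ≈ 0#
    above-harmonic f harmonic zero    U eq = trans (sym (γ≈above f (U , eq))) (harmonic (U , eq))
    above-harmonic {n} {d} f harmonic (suc j) U eq =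
      -- The covers of `U` vanish by induction, so double counting collapses to `d × a ≈ ∣ U ∣ × a`.
      -- Since d = (j + 2) + |U|, cancelling leaves (j + 2) times `a` equal to zero.
      torsionFree (suc j) a (+-cancelʳ (∣ U ∣ × a) _ _ (begin
        suc (suc j) × a ⊕ ∣ U ∣ × a        ≈⟨ ×-homo-+ a (suc (suc j)) ∣ U ∣ ⟨
        (suc (suc j) + ∣ U ∣) × a          ≡⟨ ≡.cong (_× a) eq ⟩
        d × a                              ≈⟨ d×a ⟩
        above (λ Z → ∣ Z ∣ × g Z) U        ≈⟨ coverSum-above g U ⟨
        coverSum (above g) U ⊕ ∣ U ∣ × a   ≈⟨ ⊕-congʳ (coverSum-zero U covers) ⟩
        0# ⊕ ∣ U ∣ × a                     ∎))
      where
      g = extend f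
      a = above g U

      covers : ∀ V → ∣ V ∣ ≡ suc ∣ U ∣ → above g V ≈ 0#
      covers V ∣V∣≡ = above-harmonic f harmonic j V
        (≡.trans (≡.cong (suc j +_) ∣V∣≡) (≡.trans (ℕ.+-suc (suc j) ∣ U ∣) eq))

      -- `g` lives on sets of size `d`, so weighting by |Z| is multiplication by a fixed ring
      -- element, which can be moved across the sum.
      size : ∀ Z → (d × 1#) * g Z ≈ ∣ Z ∣ × g Z
      size Z with ∣ Z ∣ ℕ.≟ d
      ... | yes ≡.refl = trans (×-assoc-* d 1# _) (×-congʳ d (*-identityˡ _))
      ... | no  _      = trans (zeroʳ _) (sym (trans (×-congʳ ∣ Z ∣ (sym (zeroˡ 0#)))
                           (trans (sym (×-assoc-* ∣ Z ∣ 0# 0#)) (zeroʳ _))))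

      d×a : d × a ≈ above (λ Z → ∣ Z ∣ × g Z) U
      d×a = begin
        d × a                            ≈⟨ ×-congʳ d (*-identityˡ a) ⟨
        d × (1# * a)                     ≈⟨ ×-assoc-* d 1# a ⟨
        (d × 1#) * a                     ≈⟨ *-∑-when (d × 1#) g (λ Z → does (U ⊆? Z)) ⟩
        above (λ Z → (d × 1#) * g Z) U   ≈⟨ above-cong size U ⟩
        above (λ Z → ∣ Z ∣ × g Z) U      ∎

    tilde-∁ : ∀ {n d} (f : Ω n d → Carrier) → Weighted.Harmonic R f →
              ∀ X → tilde f (∁ X) ≈ -1^ d * tilde f X
    tilde-∁ {n} {d} f harmonic X = begin
      tilde f (∁ X)                             ≈⟨ tilde≈below f (∁ X) ⟩
      below g (∁ X)                             ≈⟨ below-∁ g X ⟩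
      below (λ U → -1^ ∣ U ∣ * above g U) X     ≈⟨ below-cong concentrated X ⟩
      below (λ U → -1^ d * g U) X               ≈⟨ *-∑-when (-1^ d) g (λ Z → does (Z ⊆? X)) ⟨
      -1^ d * below g X                         ≈⟨ *-congˡ (tilde≈below f X) ⟨
      -1^ d * tilde f X                         ∎
      where
      g = extend f

      beyond : ∀ Z → d < ∣ Z ∣ → g Z ≈ 0#
      beyond Z d<∣Z∣ = extend-off f Z (ℕ.<⇒≢ d<∣Z∣ ∘ ≡.sym)

      both-zero : ∀ {x y} p q → x ≈ 0# → y ≈ 0# → p * x ≈ q * y
      both-zero p q x≈0 y≈0 =
        trans (trans (*-congˡ x≈0) (zeroʳ p)) (sym (trans (*-congˡ y≈0) (zeroʳ q)))

      concentrated : ∀ U → -1^ ∣ U ∣ * above g U ≈ -1^ d * g U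
      concentrated U with ℕ.<-cmp ∣ U ∣ d
      ... | tri≈ _ ∣U∣≡d _ = *-cong (^-congʳ (- 1#) ∣U∣≡d)
        (above-top U λ Z p → beyond Z (≡.subst (_< ∣ Z ∣) ∣U∣≡d p))
      ... | tri> _ _ d<∣U∣ = both-zero _ _
        (above-zero U λ Z p → beyond Z (ℕ.<-≤-trans d<∣U∣ p)) (beyond U d<∣U∣)
      ... | tri< ∣U∣<d ∣U∣≢d _ = both-zero _ _
        (above-harmonic f harmonic (d ∸ suc ∣ U ∣) U
          -- The index `d ∸ suc ∣ U ∣` is exact because |U| < d.
          (≡.trans (≡.sym (ℕ.+-suc (d ∸ suc ∣ U ∣) ∣ U ∣)) (ℕ.m∸n+n≡m ∣U∣<d)))
        (extend-off f U ∣U∣≢d)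

    χ≈T : ∀ {m n d} (G : Graph m n) (f : Ω n d → Carrier) → Weighted.Harmonic R f →
      (s : Label n) (t : Carrier) →
      Weighted.χ R f G s t ≈
        -1^ (ρ (graphic G) ⊤ + d) * t ^ʳ k G ⊤ * Weighted.T R f (graphic G) s (1# - t) 0#
    χ≈T {m} {n} {d} G f harmonic s t = trans (∑-cong {n} termwise) (sym (*-∑ {n} _ _))
      where
      termwise : ∀ A →
        tilde f (image s (∁ A)) * -1^ ∣ A ∣ * t ^ʳ k G A ≈
        (-1^ (ρ (graphic G) ⊤ + d) * t ^ʳ k G ⊤) *
          (tilde f (image s A) * ((1# - t) - 1#) ^ʳ (ρ (graphic G) ⊤ ∸ ρ (graphic G) A)
            * (0# - 1#) ^ʳ (∣ A ∣ ∸ ρ (graphic G) A))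
      termwise A = trans
        -- The complement passes through the label and then becomes the sign (-1)^d.
        (*-congʳ (*-congʳ (trans (reflexive (≡.cong (tilde f) (image-∁ s A))) (tilde-∁ f harmonic (image s A)))))
        (χ-term≈T-term t (tilde f (image s A))
          -- k(G) is at most k(G_A): adding edges never raises k, and `A ∪ ⊤` is `⊤`.
          (≡.subst (λ B → k G B ≤ k G A) (∪-zeroʳ A) (k-∪ G A ⊤))
          (k≤m G A) (Matroid.ρ≤∣_∣ (graphic G) A))

-- Torsion-freeness of the reals

open Mult (CommutativeRing.semiring ℝ-commutativeRing) using (_×_)
open Mult (CommutativeRing.semiring ℚ.+-*-commutativeRing) using (×-assoc-*) renaming (_×_ to _×ℚ_)

×ℚ1-positive : ∀ j → ℚ.Positive (suc j ×ℚ ℚ.1ℚ)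
×ℚ1-positive zero    = _
×ℚ1-positive (suc j) =
  ℚ.pos+nonNeg⇒pos ℚ.1ℚ (suc j ×ℚ ℚ.1ℚ) {{ℚ.pos⇒nonNeg (suc j ×ℚ ℚ.1ℚ) {{×ℚ1-positive j}}}}

approx-× : ∀ j x i → ℝ.approx (j × x) i ≡ j ×ℚ ℝ.approx x i
approx-× zero    x i = ≡.refl
approx-× (suc j) x i = ≡.cong (ℝ.approx x i ℚ.+_) (approx-× j x i)

ℝ-torsionFree : ∀ j x → suc j × x ≈ℝ 0ℝ → x ≈ℝ 0ℝ
ℝ-torsionFree j x jx≈0 = begin
  x                           ≈⟨ pointwise⇒≈ℝ divide ⟨
  fromℚ q⁻¹ *ℝ (suc j × x)    ≈⟨ *-congˡ jx≈0 ⟩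
  fromℚ q⁻¹ *ℝ 0ℝ             ≈⟨ zeroʳ (fromℚ q⁻¹) ⟩
  0ℝ                          ∎
  where
  open CommutativeRing ℝ-commutativeRing using (setoid; *-congˡ; zeroʳ)
  open SetoidReasoning setoid

  q = suc j ×ℚ ℚ.1ℚ

  instance
    q≢0 : ℚ.NonZero q
    q≢0 = ℚ.pos⇒nonZero q {{×ℚ1-positive j}}

  q⁻¹ = ℚ.1/ q

  divide : ∀ i → q⁻¹ ℚ.* ℝ.approx (suc j × x) i ≡ ℝ.approx x i
  divide i = let y = ℝ.approx x i in R.begin
    q⁻¹ ℚ.* ℝ.approx (suc j × x) i    R.≡⟨ ≡.cong (q⁻¹ ℚ.*_) (approx-× (suc j) x i) ⟩
    q⁻¹ ℚ.* (suc j ×ℚ y)              R.≡⟨ ≡.cong (λ z → q⁻¹ ℚ.* (suc j ×ℚ z)) (ℚ.*-identityˡ y) ⟨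
    q⁻¹ ℚ.* (suc j ×ℚ (ℚ.1ℚ ℚ.* y))   R.≡⟨ ≡.cong (q⁻¹ ℚ.*_) (×-assoc-* (suc j) ℚ.1ℚ y) ⟨
    q⁻¹ ℚ.* (q ℚ.* y)                 R.≡⟨ ℚ.*-assoc q⁻¹ q y ⟨
    (q⁻¹ ℚ.* q) ℚ.* y                 R.≡⟨ ≡.cong (ℚ._* y) (ℚ.*-inverseˡ q) ⟩
    ℚ.1ℚ ℚ.* y                        R.≡⟨ ℚ.*-identityˡ y ⟩
    y                                 R.∎
    where module R = ≡.≡-Reasoning

theorem4p1 : (m n d : ℕ) (G : Graph m n) (f : Ω n d → ℝ) → Harmonic f →
    (s : Label n) (t : ℝ) →
    χ f G s t ≈ℝ
    (-ℝ 1ℝ) ^ℝ (ρ (graphic G) ⊤ + d) *ℝ t ^ℝ k G ⊤ *ℝ T f (graphic G) s (1ℝ -ℝ t) 0ℝ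
theorem4p1 m n d G f = HarmonicSums.χ≈T ℝ-commutativeRing ℝ-torsionFree G f
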